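{- There exists an adaptive deterministic algorithm that solves the Graph Reconstruction problem with a CC oracle using $\mathcal{O}(k^3\log n)$ CC queries when the treewidth $k$ of the hidden graph is known, where $n$ is the number of vertices.
   Context: Graph Reconstruction (GR): an unknown ("hidden") simple undirected graph $G=(V,E)$ on a known vertex set $V$ with $|V|=n$ is to be determined, i.e. the algorithm must output $E$. A CC oracle, on query $S\subseteq V$, returns the partition of $S$ into the vertex sets of the connected components of the induced subgraph $G[S]$; complexity is the number of queries. An adaptive algorithm may choose queries depending on earlier answers; a deterministic algorithm must always output the hidden graph. -}

module Defs where

open import Data.Nat using (ℕ; zero; suc; _+_; _*_; _^_; _≤_)
open import Data.Nat.Logarithm using (⌈log₂_⌉)
open import Data.Fin using (Fin; toℕ) renaming (suc to fsuc)
open import Data.Fin.Subset using (Subset; _∈_; ∣_∣)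
open import Data.Bool using (Bool; true; false)
open import Data.Product using (Σ; ∃; ∃-syntax; _×_; _,_)
open import Data.Sum using (_⊎_)
open import Relation.Binary.PropositionalEquality using (_≡_)
open import Relation.Nullary using (¬_)
open import Function.Bundles using (_⇔_)

record Graph (n : ℕ) : Set where
  field
    adj   : Fin n → Fin n → Bool
    sym   : ∀ u v → adj u v ≡ adj v u
    irrefl : ∀ v → adj v v ≡ false

open Graph public

Edge : ∀ {n} → Graph n → Fin n → Fin n → Set
Edge G u v = adj G u v ≡ true

data Walk {A : Set} (R : A → A → Set) (P : A → Set) : A → A → Set where
  here : ∀ {a} → P a → Walk R P a a
  step : ∀ {a b c} → P a → (R a b ⊎ R b a) → Walk R P b c → Walk R P a c

ConnIn : ∀ {n} → Graph n → Subset n → Fin n → Fin n → Set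
ConnIn G S u v = Walk (Edge G) (λ w → w ∈ S) u v

-- Trees, represented by parent pointers: nodes Fin (suc m), node (fsuc i)
-- is joined to its parent (parent i), whose index is ≤ toℕ i < toℕ (fsuc i).

record Tree : Set where
  field
    size-1  : ℕ
    parent  : Fin size-1 → Fin (suc size-1)
    parent< : ∀ i → toℕ (parent i) ≤ toℕ i

open Tree public

TEdge : (T : Tree) → Fin (suc (size-1 T)) → Fin (suc (size-1 T)) → Set
TEdge T s t = ∃[ i ] (fsuc i ≡ s × parent T i ≡ t)

record TreeDecomp {n : ℕ} (G : Graph n) : Set where
  field
    tree      : Tree
    bag       : Fin (suc (size-1 tree)) → Subset n
    cover     : ∀ v → ∃[ t ] (v ∈ bag t)
    edgeCover : ∀ u v → Edge G u v → ∃[ t ] (u ∈ bag t × v ∈ bag t)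
    subtree   : ∀ v a b → v ∈ bag a → v ∈ bag b →
                Walk (TEdge tree) (λ t → v ∈ bag t) a b

open TreeDecomp public

BagsAtMost : ∀ {n} {G : Graph n} → TreeDecomp G → ℕ → Set
BagsAtMost D d = ∀ t → ∣ bag D t ∣ ≤ d

-- treewidth of G is exactly k: min over decompositions of (max bag size - 1) = k
TreewidthIs : ∀ {n} → Graph n → ℕ → Set
TreewidthIs G k =
  (∃[ D ] BagsAtMost {G = G} D (suc k)) ×
  (∀ (D : TreeDecomp G) → ∃[ t ] (suc k ≤ ∣ bag D t ∣))

-- CC oracle. The answer to query S is the partition of S into the vertex
-- sets of the components of G[S], given as its "same block" relation:
-- ans u v = true iff u, v ∈ S and u, v in the same component of G[S].

Answer : ℕ → Set
Answer n = Fin n → Fin n → Bool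

CorrectCC : ∀ {n} → Graph n → Subset n → Answer n → Set
CorrectCC G S ans = ∀ u v → (ans u v ≡ true) ⇔ (u ∈ S × v ∈ S × ConnIn G S u v)

-- Adaptive deterministic algorithms: decision trees whose internal nodes
-- ask a CC query and branch on the answer, and whose leaves output an
-- edge set (as an adjacency function).
data Alg (n : ℕ) : Set where
  output : (Fin n → Fin n → Bool) → Alg n
  query  : Subset n → (Answer n → Alg n) → Alg n

data Run {n : ℕ} (G : Graph n) : Alg n → ℕ → (Fin n → Fin n → Bool) → Set where
  done : ∀ {E} → Run G (output E) 0 E
  ask  : ∀ {S k ans q E} → CorrectCC G S ans → Run G (k ans) q E →
         Run G (query S k) (suc q) E

SameEdges : ∀ {n} → (Fin n → Fin n → Bool) → Graph n → Set
SameEdges E G = ∀ u v → E u v ≡ adj G u v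

-- O(k^3 log n) bound with constant C (with +1's so that k = 0, n ≤ 1 make sense)
Bound : ℕ → ℕ → ℕ → ℕ
Bound C k n = C * (suc k ^ 3) * suc ⌈log₂ n ⌉

{-# OPTIONS --safe #-}
-- The algorithm works in two rounds.
--
-- Round 1. A random set containing each vertex with probability 1/(2k+2)
-- contains two given vertices and avoids k others with probability Ω(1/k²), so
-- O(k³ log n) sets do this for all choices simultaneously (found by
-- derandomised greedy choice). Vertices u, v with no common bag of a width-k
-- decomposition are separated by the at most k vertices common to a bag and
-- its parent, so one of these queries splits u from v. The pairs never split
-- thus form a known graph H with G ⊆ H ⊆ (pairs sharing a bag).
--
-- Round 2. Such an H has an ordering and a (k+1)-colouring in which the earlier
-- neighbours of every vertex, and the vertex itself, have distinct colours.
-- Then any two colour classes span a forest in H, in which two H-adjacent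
-- vertices are connected in G only by an edge; so one query for each pair of
-- colours determines G.
module Submission where

open import Defs
open import Data.Bool as Bool using (Bool; true; false; _∧_; if_then_else_)
open import Data.Fin as Fin using (Fin; zero; suc; toℕ; fromℕ<; combine; finToFun; funToFin)
open import Data.Fin.Properties as Fin using
  ( any?; all?; toℕ-injective; toℕ-fromℕ<; toℕ<n; combine-monoˡ-<; combine-injectiveʳ
  ; ¬∀⟶∃¬; finToFun-funToFin )
open import Data.Fin.Subset using (Subset; _∈_; _∉_; ∣_∣; ⁅_⁆; _∪_; _∩_; _-_; ⊥; ⊤)
open import Data.Fin.Subset.Properties using
  ( _∈?_; x∈⁅x⁆; x∈⁅y⁆⇒x≡y; x∈p∪q⁺; x∈p∪q⁻; x∈p∩q⁺; x∈p∩q⁻; ∣⁅x⁆∣≡1; ∣⊥∣≡0; ∣⊤∣≡n; ∣p∣≤n; ∣p∣≤∣x∷p∣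
  ; p⊂q⇒∣p∣<∣q∣; p⊆q⇒∣p∣≤∣q∣; x∈p∧x≢y⇒x∈p-y; x∈p⇒∣p-x∣<∣p∣; p∩q⊆p; p─q⊆p )
open import Data.List using (List; []; _∷_; _++_; length; map; cartesianProductWith; allFin)
open import Data.List.Properties using (length-map; length-++; length-tabulate)
open import Data.List.Membership.Propositional using () renaming (_∈_ to _∈ˡ_)
open import Data.List.Membership.Propositional.Properties using
  (∈-map⁺; ∈-++⁺ˡ; ∈-++⁺ʳ; ∈-allFin; ∈-cartesianProductWith⁺)
open import Data.List.Relation.Unary.All as All using (All; []; _∷_)
import Data.List.Relation.Unary.All.Properties as All
open import Data.List.Relation.Unary.Any as Any using (Any; here; there)
open import Data.Maybe using (Maybe; just; nothing)
open import Data.Nat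
open import Data.Nat.Induction using (<-wellFounded)
open import Data.Nat.ListAction using (sum)
open import Data.Nat.Logarithm using (⌈log₂_⌉)
open import Data.Nat.Logarithm.Core using (⌈log2⌉)
open import Data.Nat.Properties
open import Data.Nat.Tactic.RingSolver using (solve-∀)
open import Data.Product using (Σ; ∃; ∃-syntax; _×_; _,_; proj₁; proj₂)
open import Data.Sum using (_⊎_; inj₁; inj₂; [_,_]; swap)
open import Data.Vec using (Vec; []; _∷_; here; there; tabulate)
open import Data.Vec.Properties using (lookup∘tabulate; lookup⇒[]=; []=⇒lookup)
open import Function using (_∘_; id)
open import Function.Bundles using (_⇔_; mk⇔; Equivalence)
open import Induction.WellFounded using (Acc; acc)
open import Relation.Binary using (tri<; tri≈; tri>)
open import Relation.Binary.PropositionalEquality using (_≡_; _≢_; refl; trans; cong; cong₂; subst; subst₂)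
  renaming (sym to ≡-sym)
open import Relation.Nullary using (¬_; Dec; yes; no; does; contradiction)
open import Relation.Nullary.Decidable using (dec-true; map′; _×-dec_; _⊎-dec_; _→-dec_; ¬?)

private variable
  n k : ℕ

-- Elementary inequalities

-- Induction along the well-founded recursion of `⌈log2⌉`, which passes from `2 + n` to
-- `suc ⌈ n /2⌉`.
n≤2^⌈log₂n⌉ : ∀ n → n ≤ 2 ^ ⌈log₂ n ⌉
n≤2^⌈log₂n⌉ n = go n (<-wellFounded n)
  where
  open ≤-Reasoning
  go : ∀ n (a : Acc _<_ n) → n ≤ 2 ^ ⌈log2⌉ n a
  go 0 _ = z≤n
  go 1 _ = ≤-refl
  go (suc (suc n)) (acc rs) = begin
    2 + n                           ≡⟨ cong (2 +_) (⌊n/2⌋+⌈n/2⌉≡n n) ⟨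
    2 + (⌊ n /2⌋ + ⌈ n /2⌉)         ≤⟨ +-monoʳ-≤ 2 (+-monoˡ-≤ ⌈ n /2⌉ (⌊n/2⌋≤⌈n/2⌉ n)) ⟩
    2 + (⌈ n /2⌉ + ⌈ n /2⌉)         ≡⟨ double ⌈ n /2⌉ ⟩
    2 * suc ⌈ n /2⌉                 ≤⟨ *-monoʳ-≤ 2 (go (suc ⌈ n /2⌉) (rs _)) ⟩
    2 * 2 ^ ⌈log2⌉ (suc ⌈ n /2⌉) _  ∎
    where
    double : ∀ m → 2 + (m + m) ≡ 2 * suc m
    double = solve-∀

*-swap : ∀ x y z → x * (y * z) ≡ y * (x * z)
*-swap = solve-∀

*-^-distrib : ∀ m n o → (m * n) ^ o ≡ m ^ o * n ^ o
*-^-distrib m n zero    = refl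
*-^-distrib m n (suc o) = trans (cong (m * n *_) (*-^-distrib m n o)) (interchange m n (m ^ o) (n ^ o))
  where
  interchange : ∀ m n x y → m * n * (x * y) ≡ m * x * (n * y)
  interchange = solve-∀

-- Bernoulli's inequality (1 + 1/p)^b ≥ 1 + b/p, multiplied by p^(b+1).
bernoulli : ∀ p b → (p + b) * p ^ b ≤ p * suc p ^ b
bernoulli p zero    = ≤-reflexive (cong (_* 1) (+-identityʳ p))
bernoulli p (suc b) = begin
  (p + suc b) * (p * p ^ b)              ≤⟨ m≤m+n _ (b * p ^ b) ⟩
  (p + suc b) * (p * p ^ b) + b * p ^ b  ≡⟨ expand p b (p ^ b) ⟩
  suc p * ((p + b) * p ^ b)              ≤⟨ *-monoʳ-≤ (suc p) (bernoulli p b) ⟩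
  suc p * (p * suc p ^ b)                ≡⟨ *-swap (suc p) p (suc p ^ b) ⟩
  p * (suc p * suc p ^ b)                ∎
  where
  open ≤-Reasoning
  expand : ∀ p b x → (p + suc b) * (p * x) + b * x ≡ suc p * ((p + b) * x)
  expand = solve-∀

-- Consequently `p` rounds that each keep at most a fraction p/(p+1) of a list at least halve it.
2p^p≤[1+p]^p : ∀ p .{{_ : NonZero p}} → 2 * p ^ p ≤ suc p ^ p
2p^p≤[1+p]^p p = *-cancelˡ-≤ p (begin
  p * (2 * p ^ p)  ≡⟨ regroup p (p ^ p) ⟩
  (p + p) * p ^ p  ≤⟨ bernoulli p p ⟩
  p * suc p ^ p    ∎)
  where
  open ≤-Reasoning
  regroup : ∀ p x → p * (2 * x) ≡ (p + p) * x
  regroup = solve-∀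

-- Bernoulli's inequality (1 - 1/(p+1))^b ≥ 1 - b/(p+1), cleared of denominators and subtraction.
[1+p]^b-upper : ∀ p b → suc p * suc p ^ b ≤ suc p * p ^ b + b * suc p ^ b
[1+p]^b-upper p zero    = ≤-reflexive (≡-sym (+-identityʳ (suc p * 1)))
[1+p]^b-upper p (suc b) = begin
  suc p * (suc p * suc p ^ b)                          ≤⟨ *-monoʳ-≤ (suc p) ([1+p]^b-upper p b) ⟩
  suc p * (suc p * p ^ b + b * suc p ^ b)              ≡⟨ expand p b (p ^ b) (suc p ^ b) ⟩
  suc p * (p * p ^ b) + (suc p * p ^ b + b * (suc p * suc p ^ b))
    ≤⟨ +-monoʳ-≤ (suc p * (p * p ^ b)) (+-monoˡ-≤ _ (*-monoʳ-≤ (suc p) (^-monoˡ-≤ b (n≤1+n p)))) ⟩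
  suc p * (p * p ^ b) + (suc p * suc p ^ b + b * (suc p * suc p ^ b)) ∎
  where
  open ≤-Reasoning
  expand : ∀ p b x y → suc p * (suc p * x + b * y) ≡ suc p * (p * x) + (suc p * x + b * (suc p * y))
  expand = solve-∀

∣p∪q∣≤∣p∣+∣q∣ : ∀ (p q : Subset n) → ∣ p ∪ q ∣ ≤ ∣ p ∣ + ∣ q ∣
∣p∪q∣≤∣p∣+∣q∣ []          []          = z≤n
∣p∪q∣≤∣p∣+∣q∣ (true ∷ p)  (y ∷ q)     =
  s≤s (≤-trans (∣p∪q∣≤∣p∣+∣q∣ p q) (+-monoʳ-≤ ∣ p ∣ (∣p∣≤∣x∷p∣ y q)))
∣p∪q∣≤∣p∣+∣q∣ (false ∷ p) (true ∷ q)  = ≤-trans (s≤s (∣p∪q∣≤∣p∣+∣q∣ p q)) (≤-reflexive (≡-sym (+-suc ∣ p ∣ ∣ q ∣)))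
∣p∪q∣≤∣p∣+∣q∣ (false ∷ p) (false ∷ q) = ∣p∪q∣≤∣p∣+∣q∣ p q

-- Families of sets realising all small patterns

-- A pattern prescribes membership (just true), non-membership (just false)
-- or nothing for each vertex.
Pattern : ℕ → Set
Pattern n = Vec (Maybe Bool) n

fits₁ : Bool → Maybe Bool → Bool
fits₁ true  (just false) = false
fits₁ false (just true)  = false
fits₁ _     _            = true

fits : Subset n → Pattern n → Bool
fits []      []      = true
fits (s ∷ S) (x ∷ r) = fits₁ s x ∧ fits S r

hits : Subset n → List (Pattern n) → ℕ
hits S []      = 0
hits S (r ∷ B) with fits S r
... | true  = suc (hits S B)
... | false = hits S B

misses : Subset n → List (Pattern n) → List (Pattern n)
misses S []      = []
misses S (r ∷ B) with fits S r
... | true  = misses S B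
... | false = r ∷ misses S B

hits+misses : ∀ (S : Subset n) B → hits S B + length (misses S B) ≡ length B
hits+misses S []      = refl
hits+misses S (r ∷ B) with fits S r
... | true  = cong suc (hits+misses S B)
... | false = trans (+-suc _ _) (cong suc (hits+misses S B))

∈-misses : ∀ (S : Subset n) {r} B → r ∈ˡ B → fits S r ≢ true → r ∈ˡ misses S B
∈-misses S (r ∷ B) r∈ ¬fit with fits S r in eq
∈-misses S (r ∷ B) (here refl) ¬fit | true  = contradiction eq ¬fit
∈-misses S (r ∷ B) (there r∈)  ¬fit | true  = ∈-misses S B r∈ ¬fit
∈-misses S (r ∷ B) (here refl) ¬fit | false = here refl
∈-misses S (r ∷ B) (there r∈)  ¬fit | false = there (∈-misses S B r∈ ¬fit)

misses-All : ∀ {P : Pattern n → Set} (S : Subset n) {B} → All P B → All P (misses S B)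
misses-All S {[]}    []         = []
misses-All S {r ∷ B} (px ∷ pxs) with fits S r
... | true  = misses-All S pxs
... | false = px ∷ misses-All S pxs

restrict : Bool → List (Pattern (suc n)) → List (Pattern n)
restrict s []            = []
restrict s ((x ∷ r) ∷ B) with fits₁ s x
... | true  = r ∷ restrict s B
... | false = restrict s B

hits-restrict : ∀ s (S : Subset n) B → hits S (restrict s B) ≡ hits (s ∷ S) B
hits-restrict s S []            = refl
hits-restrict s S ((x ∷ r) ∷ B) with fits₁ s x
... | false = hits-restrict s S B
... | true  with fits S r
...   | true  = cong suc (hits-restrict s S B)
...   | false = hits-restrict s S B

-- weight r counts the maps Fin n → Fin (suc p) whose fibre over 0 fits r:
-- a random fibre is the random set that the greedy choice derandomises.
module _ (p : ℕ) where

  weight₁ : Maybe Bool → ℕ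
  weight₁ (just true)  = 1
  weight₁ (just false) = p
  weight₁ nothing      = suc p

  weight : Pattern n → ℕ
  weight []      = 1
  weight (x ∷ r) = weight₁ x * weight r

  total : List (Pattern n) → ℕ
  total B = sum (map weight B)

  -- The first vertex can be mapped to 0 in one way and elsewhere in `p` ways.
  total-restrict : ∀ (B : List (Pattern (suc n))) →
                   total B ≡ total (restrict true B) + p * total (restrict false B)
  total-restrict []                      = ≡-sym (*-zeroʳ p)
  total-restrict ((just true ∷ r) ∷ B)   =
    trans (cong (1 * weight r +_) (total-restrict B)) (lemma (weight r) _ _)
    where
    lemma : ∀ w t f → 1 * w + (t + f) ≡ (w + t) + f
    lemma = solve-∀
  total-restrict ((just false ∷ r) ∷ B)  =
    trans (cong (p * weight r +_) (total-restrict B)) (lemma p (weight r) (total (restrict true B)) (total (restrict false B)))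
    where
    lemma : ∀ p w t f → p * w + (t + p * f) ≡ t + p * (w + f)
    lemma = solve-∀
  total-restrict ((nothing ∷ r) ∷ B)     =
    trans (cong (suc p * weight r +_) (total-restrict B)) (lemma p (weight r) (total (restrict true B)) (total (restrict false B)))
    where
    lemma : ∀ p w t f → suc p * w + (t + p * f) ≡ (w + t) + p * (w + f)
    lemma = solve-∀

  total-[] : ∀ (B : List (Pattern 0)) → total B ≡ hits [] B
  total-[] []       = refl
  total-[] ([] ∷ B) = cong suc (total-[] B)

  -- `total B` is `suc p` times a weighted mean of the two restricted totals, so the larger of them
  -- suffices.
  bestSide : ∀ (B : List (Pattern (suc n))) → ∃[ s ] total B ≤ suc p * total (restrict s B)
  bestSide B with ≤-total (total (restrict false B)) (total (restrict true B))
  ... | inj₁ f≤t = true , ≤-trans (≤-reflexive (total-restrict B)) (+-monoʳ-≤ _ (*-monoʳ-≤ p f≤t))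
  ... | inj₂ t≤f = false , ≤-trans (≤-reflexive (total-restrict B)) (+-monoˡ-≤ _ t≤f)

  -- Method of conditional expectations: `total B` over `suc p ^ n` is the expected number of hits
  -- of a random fibre, and fixing the vertices one by one on the better side never lowers it.
  derandomise : ∀ n (B : List (Pattern n)) → ∃[ S ] total B ≤ hits S B * suc p ^ n
  derandomise zero    B = [] , ≤-reflexive (trans (total-[] B) (≡-sym (*-identityʳ _)))
  derandomise (suc n) B =
    let s , best  = bestSide B
        S , bound = derandomise n (restrict s B)
    in s ∷ S , (begin
      total B                                      ≤⟨ best ⟩
      suc p * total (restrict s B)                 ≤⟨ *-monoʳ-≤ (suc p) bound ⟩
      suc p * (hits S (restrict s B) * suc p ^ n)  ≡⟨ *-swap (suc p) (hits S (restrict s B)) (suc p ^ n) ⟩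
      hits S (restrict s B) * suc p ^ suc n        ≡⟨ cong (_* suc p ^ suc n) (hits-restrict s S B) ⟩
      hits (s ∷ S) B * suc p ^ suc n               ∎)
    where open ≤-Reasoning

  module _ (P : ℕ) where

    -- A random fibre fits `r` with probability at least 1/(P+1).
    Heavy : Pattern n → Set
    Heavy {n} r = suc p ^ n ≤ suc P * weight r

    length≤total : ∀ {B : List (Pattern n)} → All Heavy B → length B * suc p ^ n ≤ suc P * total B
    length≤total {B = []}    []       = z≤n
    length≤total {n} {B = r ∷ B} (h ∷ hs) = begin
      suc p ^ n + length B * suc p ^ n     ≤⟨ +-mono-≤ h (length≤total hs) ⟩
      suc P * weight r + suc P * total B   ≡⟨ *-distribˡ-+ (suc P) (weight r) (total B) ⟨
      suc P * (weight r + total B)         ∎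
      where open ≤-Reasoning

    -- The expected number of hits is at least `length B` over `suc P`, so a set attaining it leaves
    -- at most a fraction P/(P+1) of the patterns.
    pick : ∀ (B : List (Pattern n)) → All Heavy B →
           ∃[ S ] length (misses S B) * suc P ≤ length B * P
    pick {n} B hs = let S , bound = derandomise n B in S , (let
      h = hits S B
      m = length (misses S B)
      len≤ : length B ≤ suc P * h
      len≤ = *-cancelʳ-≤ (length B) (suc P * h) (suc p ^ n) {{m^n≢0 (suc p) n}} (begin
        length B * suc p ^ n      ≤⟨ length≤total hs ⟩
        suc P * total B           ≤⟨ *-monoʳ-≤ (suc P) bound ⟩
        suc P * (h * suc p ^ n)   ≡⟨ *-assoc (suc P) h _ ⟨
        suc P * h * suc p ^ n     ∎)
      m≤ : m ≤ P * h
      m≤ = +-cancelˡ-≤ h m (P * h) (≤-trans (≤-reflexive (hits+misses S B)) len≤)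
      in begin
      m * suc P       ≡⟨ *-suc m P ⟩
      m + m * P       ≤⟨ +-monoˡ-≤ (m * P) m≤ ⟩
      P * h + m * P   ≡⟨ regroup P h m ⟩
      (h + m) * P     ≡⟨ cong (_* P) (hits+misses S B) ⟩
      length B * P    ∎)
      where
      open ≤-Reasoning
      regroup : ∀ P h m → P * h + m * P ≡ (h + m) * P
      regroup = solve-∀

    -- The numerical hypothesis says that after `m` picks fewer than one pattern is left, hence
    -- none.
    greedy : ∀ m (B : List (Pattern n)) → All Heavy B → length B * P ^ m < suc P ^ m →
             ∃[ Ss ] length Ss ≡ m × (∀ {r} → r ∈ˡ B → Any (λ S → fits S r ≡ true) Ss)
    greedy zero    []      hs small = [] , refl , λ ()
    greedy zero    (_ ∷ _) hs (s≤s ())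
    greedy (suc m) B       hs small =
      let S , shrunk = pick B hs
          Ss , len , covers = greedy m (misses S B) (misses-All S hs) (smaller S shrunk)
      in S ∷ Ss , cong suc len , λ r∈ → extend S Ss covers r∈
      where
      open ≤-Reasoning
      smaller : ∀ S → length (misses S B) * suc P ≤ length B * P →
                length (misses S B) * P ^ m < suc P ^ m
      smaller S shrunk = *-cancelˡ-< (suc P) _ _ (begin-strict
        suc P * (length (misses S B) * P ^ m)  ≡⟨ *-swap (suc P) (length (misses S B)) (P ^ m) ⟩
        length (misses S B) * (suc P * P ^ m)  ≡⟨ *-assoc (length (misses S B)) (suc P) (P ^ m) ⟨
        length (misses S B) * suc P * P ^ m    ≤⟨ *-monoˡ-≤ (P ^ m) shrunk ⟩
        length B * P * P ^ m                   ≡⟨ *-assoc (length B) P (P ^ m) ⟩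
        length B * (P * P ^ m)                 <⟨ small ⟩
        suc P * suc P ^ m                      ∎)
      extend : ∀ S Ss → (∀ {r} → r ∈ˡ misses S B → Any (λ S → fits S r ≡ true) Ss) →
               ∀ {r} → r ∈ˡ B → Any (λ S → fits S r ≡ true) (S ∷ Ss)
      extend S Ss covers {r} r∈ with fits S r in eq
      ... | true  = here eq
      ... | false = there (covers (∈-misses S B r∈ (λ fit → contradiction (trans (≡-sym eq) fit) λ ())))

-- Patterns with at most `a` vertices required and at most `b` forbidden

patterns : ℕ → ℕ → ∀ n → List (Pattern n)
trues falses : ℕ → ℕ → ∀ n → List (Pattern (suc n))
patterns a b zero    = [] ∷ []
patterns a b (suc n) = map (nothing ∷_) (patterns a b n) ++ trues a b n ++ falses a b n
trues zero    b n = []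
trues (suc a) b n = map (just true ∷_) (patterns a b n)
falses a zero    n = []
falses a (suc b) n = map (just false ∷_) (patterns a b n)

-- With L = 2n+1 and a + b = d+1, one more vertex adds at most two lists of length at most L^d to
-- one of length at most L^(d+1), and L^(d+1) + 2L^d ≤ (L+2)^(d+1).
length-patterns : ∀ a b n → length (patterns a b n) ≤ suc (2 * n) ^ (a + b)
length-patterns a b zero = ≤-reflexive (≡-sym (^-zeroˡ (a + b)))
length-patterns a b (suc n) = begin
  length (patterns a b (suc n))
    ≡⟨ trans (length-++ (map (nothing ∷_) (patterns a b n)))
             (cong₂ _+_ (length-map _ (patterns a b n)) (length-++ (trues a b n))) ⟩
  length (patterns a b n) + (length (trues a b n) + length (falses a b n))
    ≤⟨ cases a b (length-patterns a b n) ⟩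
  (2 + suc (2 * n)) ^ (a + b)
    ≡⟨ cong (λ m → suc m ^ (a + b)) (*-suc 2 n) ⟨
  suc (2 * suc n) ^ (a + b)  ∎
  where
  open ≤-Reasoning
  L = suc (2 * n)
  raise : ∀ d {x t f} → x ≤ L ^ suc d → t ≤ L ^ d → f ≤ L ^ d → x + (t + f) ≤ (2 + L) ^ suc d
  raise d {x} {t} {f} x≤ t≤ f≤ = begin
    x + (t + f)                        ≤⟨ +-mono-≤ x≤ (+-mono-≤ t≤ f≤) ⟩
    L * L ^ d + (L ^ d + L ^ d)        ≡⟨ collect L (L ^ d) ⟩
    (2 + L) * L ^ d                    ≤⟨ *-monoʳ-≤ (2 + L) (^-monoˡ-≤ d (m≤n+m L 2)) ⟩
    (2 + L) * (2 + L) ^ d              ∎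
    where
    collect : ∀ L y → L * y + (y + y) ≡ (2 + L) * y
    collect = solve-∀
  mapped : ∀ (x : Maybe Bool) a b → length (map (x ∷_) (patterns a b n)) ≤ L ^ (a + b)
  mapped x a b = ≤-trans (≤-reflexive (length-map _ (patterns a b n))) (length-patterns a b n)
  cases : ∀ a b {x} → x ≤ L ^ (a + b) → x + (length (trues a b n) + length (falses a b n)) ≤ (2 + L) ^ (a + b)
  cases zero    zero    x≤ = ≤-trans (≤-reflexive (+-identityʳ _)) x≤
  cases zero    (suc b) x≤ = raise b x≤ z≤n (mapped (just false) 0 b)
  cases (suc a) zero    x≤ = raise (a + 0) x≤ (mapped (just true) a 0) z≤n
  cases (suc a) (suc b) x≤ = raise (a + suc b) x≤ (mapped (just true) a (suc b))
    (≤-trans (mapped (just false) (suc a) b) (≤-reflexive (cong (L ^_) (≡-sym (+-suc a b)))))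

module _ (p : ℕ) where

  -- A random fibre contains each vertex independently with probability 1/(p+1), so it fits such a
  -- pattern with probability at least p^b/(p+1)^(a+b).
  patterns-weight : ∀ a b n →
    All (λ r → suc p ^ n * p ^ b ≤ weight p r * (suc p ^ a * suc p ^ b)) (patterns a b n)
  patterns-weight a b zero    = base ∷ []
    where
    open ≤-Reasoning
    -- Allowance left over at the end only weakens the bound.
    base : 1 * p ^ b ≤ 1 * (suc p ^ a * suc p ^ b)
    base = *-monoʳ-≤ 1 (begin
      p ^ b                   ≤⟨ ^-monoˡ-≤ b (n≤1+n p) ⟩
      suc p ^ b               ≤⟨ m≤n*m (suc p ^ b) (suc p ^ a) {{m^n≢0 (suc p) a}} ⟩
      suc p ^ a * suc p ^ b   ∎)
  patterns-weight a b (suc n) =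
    All.++⁺ (All.map⁺ (All.map (λ {r} → free {weight p r}) (patterns-weight a b n)))
      (All.++⁺ (inside a) (outside b))
    where
    open ≤-Reasoning
    free : ∀ {w x} → suc p ^ n * p ^ b ≤ w * x → suc p * suc p ^ n * p ^ b ≤ suc p * w * x
    free {w} {x} h = begin
      suc p * suc p ^ n * p ^ b    ≡⟨ *-assoc (suc p) (suc p ^ n) (p ^ b) ⟩
      suc p * (suc p ^ n * p ^ b)  ≤⟨ *-monoʳ-≤ (suc p) h ⟩
      suc p * (w * x)              ≡⟨ *-assoc (suc p) w x ⟨
      suc p * w * x                ∎
    inside : ∀ a → All (λ r → suc p ^ suc n * p ^ b ≤ weight p r * (suc p ^ a * suc p ^ b)) (trues a b n)
    inside zero    = []
    inside (suc a) = All.map⁺ (All.map (λ {r} h → begin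
      suc p * suc p ^ n * p ^ b                   ≤⟨ free {weight p r} h ⟩
      suc p * weight p r * (suc p ^ a * suc p ^ b) ≡⟨ regroup (suc p) (weight p r) (suc p ^ a) (suc p ^ b) ⟩
      1 * weight p r * (suc p * suc p ^ a * suc p ^ b) ∎) (patterns-weight a b n))
      where
      regroup : ∀ q w x y → q * w * (x * y) ≡ 1 * w * (q * x * y)
      regroup = solve-∀
    outside : ∀ b → All (λ r → suc p ^ suc n * p ^ b ≤ weight p r * (suc p ^ a * suc p ^ b)) (falses a b n)
    outside zero    = []
    outside (suc b) = All.map⁺ (All.map (λ {r} h → begin
      suc p * suc p ^ n * (p * p ^ b)               ≡⟨ regroupˡ (suc p) (suc p ^ n) p (p ^ b) ⟩
      suc p * p * (suc p ^ n * p ^ b)               ≤⟨ *-monoʳ-≤ (suc p * p) h ⟩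
      suc p * p * (weight p r * (suc p ^ a * suc p ^ b)) ≡⟨ regroupʳ (suc p) p (weight p r) (suc p ^ a) (suc p ^ b) ⟩
      p * weight p r * (suc p ^ a * (suc p * suc p ^ b)) ∎) (patterns-weight a b n))
      where
      regroupˡ : ∀ q x p y → q * x * (p * y) ≡ q * p * (x * y)
      regroupˡ = solve-∀
      regroupʳ : ∀ q p w x y → q * p * (w * (x * y)) ≡ p * w * (x * (q * y))
      regroupʳ = solve-∀

-- On an overlap `I` wins, whence the condition `w ∉ I` in `fits-outside`.
demand : Subset n → Subset n → Pattern n
demand []          []          = []
demand (true ∷ I)  (x ∷ X)     = just true ∷ demand I X
demand (false ∷ I) (true ∷ X)  = just false ∷ demand I X
demand (false ∷ I) (false ∷ X) = nothing ∷ demand I X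

∈-patterns : ∀ (I X : Subset n) a b → ∣ I ∣ ≤ a → ∣ X ∣ ≤ b → demand I X ∈ˡ patterns a b n
∈-patterns []          []          a       b       I≤       X≤       = here refl
∈-patterns (true ∷ I)  (x ∷ X)     (suc a) b       (s≤s I≤) X≤       =
  ∈-++⁺ʳ (map (nothing ∷_) (patterns (suc a) b _))
    (∈-++⁺ˡ (∈-map⁺ (just true ∷_) (∈-patterns I X a b I≤ (≤-trans (∣p∣≤∣x∷p∣ x X) X≤))))
∈-patterns (false ∷ I) (true ∷ X)  a       (suc b) I≤       (s≤s X≤) =
  ∈-++⁺ʳ (map (nothing ∷_) (patterns a (suc b) _))
    (∈-++⁺ʳ (trues a (suc b) _) (∈-map⁺ (just false ∷_) (∈-patterns I X a b I≤ X≤)))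
∈-patterns (false ∷ I) (false ∷ X) a       b       I≤       X≤       =
  ∈-++⁺ˡ (∈-map⁺ (nothing ∷_) (∈-patterns I X a b I≤ X≤))

fits-inside : ∀ (S I X : Subset n) → fits S (demand I X) ≡ true → ∀ {w} → w ∈ I → w ∈ S
fits-inside (true ∷ S)  (true ∷ I)  (x ∷ X)     fit here        = here
fits-inside (true ∷ S)  (true ∷ I)  (x ∷ X)     fit (there w∈I) = there (fits-inside S I X fit w∈I)
fits-inside (false ∷ S) (false ∷ I) (true ∷ X)  fit (there w∈I) = there (fits-inside S I X fit w∈I)
fits-inside (true ∷ S)  (false ∷ I) (false ∷ X) fit (there w∈I) = there (fits-inside S I X fit w∈I)
fits-inside (false ∷ S) (false ∷ I) (false ∷ X) fit (there w∈I) = there (fits-inside S I X fit w∈I)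

fits-outside : ∀ (S I X : Subset n) → fits S (demand I X) ≡ true → ∀ {w} → w ∉ I → w ∈ X → w ∉ S
fits-outside (s ∷ S)     (true ∷ I)  (x ∷ X)     fit w∉I here        w∈S         = w∉I here
fits-outside (true ∷ S)  (true ∷ I)  (x ∷ X)     fit w∉I (there w∈X) (there w∈S) =
  fits-outside S I X fit (w∉I ∘ there) w∈X w∈S
fits-outside (false ∷ S) (false ∷ I) (true ∷ X)  fit w∉I (there w∈X) (there w∈S) =
  fits-outside S I X fit (w∉I ∘ there) w∈X w∈S
fits-outside (true ∷ S)  (false ∷ I) (false ∷ X) fit w∉I (there w∈X) (there w∈S) =
  fits-outside S I X fit (w∉I ∘ there) w∈X w∈S
fits-outside (false ∷ S) (false ∷ I) (false ∷ X) fit w∉I (there w∈X) (there w∈S) =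
  fits-outside S I X fit (w∉I ∘ there) w∈X w∈S

-- Separating families

Separates : Subset n → Fin n → Fin n → Subset n → Set
Separates S u v X = u ∈ S × v ∈ S × (∀ {w} → w ∈ X → w ∉ S)

abstract
  -- With p = 2k+1 a random fibre fits a pattern with probability at least 1/(2(2k+2)²).
  separatingFamily : ∀ n k → ∃[ Ss ]
    length Ss ≤ 8 * (suc k * suc k) * ((2 + k) * (2 + ⌈log₂ n ⌉)) ×
    (∀ u v (X : Subset n) → u ∉ X → v ∉ X → ∣ X ∣ ≤ k → Any (λ S → Separates S u v X) Ss)
  separatingFamily n k =
    let Ss , len , covers = greedy p P (P * j) (patterns 2 k n) heavy few
    in Ss , (begin
        length Ss                        ≡⟨ len ⟩
        P * j                            ≤⟨ *-monoˡ-≤ j (n≤1+n P) ⟩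
        suc P * j                        ≡⟨ cong (_* j) (size k) ⟩
        8 * (suc k * suc k) * j          ∎) ,
      λ u v X u∉X v∉X X≤k →
        let I = ⁅ u ⁆ ∪ ⁅ v ⁆ in
        Any.map (λ {S} fit →
            fits-inside S I X fit (x∈p∪q⁺ (inj₁ (x∈⁅x⁆ u))) ,
            fits-inside S I X fit (x∈p∪q⁺ (inj₂ (x∈⁅x⁆ v))) ,
            λ {w} w∈X → fits-outside S I X fit (avoid u∉X v∉X w∈X) w∈X)
          (covers (∈-patterns I X 2 k
            (≤-trans (∣p∪q∣≤∣p∣+∣q∣ ⁅ u ⁆ ⁅ v ⁆) (≤-reflexive (cong₂ _+_ (∣⁅x⁆∣≡1 u) (∣⁅x⁆∣≡1 v)))) X≤k))
    where
    open ≤-Reasoning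
    K p q P j : ℕ
    K = suc k
    p = suc (2 * k)
    q = suc p
    -- `suc P` is 2q² = 8(k+1)², the inverse of the probability bound.
    P = 7 + 8 * (2 * k + k * k)
    -- Chosen so that 2^j = (4 · 2^⌈log₂ n⌉)^(k+2) exceeds (2n+1)^(k+2), the bound on the number of
    -- patterns.
    j = (2 + k) * (2 + ⌈log₂ n ⌉)
    size : ∀ k → 8 + 8 * (2 * k + k * k) ≡ 8 * (suc k * suc k)
    size = solve-∀
    avoid : ∀ {u v : Fin n} {X} → u ∉ X → v ∉ X → ∀ {w} → w ∈ X → w ∉ ⁅ u ⁆ ∪ ⁅ v ⁆
    avoid {u} {v} u∉X v∉X w∈X w∈I with x∈p∪q⁻ ⁅ u ⁆ ⁅ v ⁆ w∈I
    ... | inj₁ w∈u = u∉X (subst (_∈ _) (x∈⁅y⁆⇒x≡y u w∈u) w∈X)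
    ... | inj₂ w∈v = v∉X (subst (_∈ _) (x∈⁅y⁆⇒x≡y v w∈v) w∈X)
    -- The probability (p/q)^k of avoiding `k` vertices is at least 1 - k/(2k+2), hence at least
    -- 1/2.
    q^k≤2p^k : q ^ k ≤ 2 * p ^ k
    q^k≤2p^k = *-cancelˡ-≤ K (+-cancelʳ-≤ (k * q ^ k) _ _ (begin
      K * q ^ k + k * q ^ k          ≤⟨ m≤m+n _ (q ^ k) ⟩
      K * q ^ k + k * q ^ k + q ^ k  ≡⟨ merge k (q ^ k) ⟩
      q * q ^ k                      ≤⟨ [1+p]^b-upper p k ⟩
      q * p ^ k + k * q ^ k          ≡⟨ cong (_+ k * q ^ k) (halve k (p ^ k)) ⟩
      K * (2 * p ^ k) + k * q ^ k    ∎))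
      where
      merge : ∀ k x → suc k * x + k * x + x ≡ suc (suc (2 * k)) * x
      merge = solve-∀
      halve : ∀ k x → suc (suc (2 * k)) * x ≡ suc k * (2 * x)
      halve = solve-∀
    heavy : All (Heavy p P) (patterns 2 k n)
    heavy = All.map (λ {r} h → *-cancelʳ-≤ (q ^ n) (suc P * weight p r) (p ^ k) {{m^n≢0 p k}} (begin
      q ^ n * p ^ k                         ≤⟨ h ⟩
      weight p r * (q ^ 2 * q ^ k)          ≤⟨ *-monoʳ-≤ (weight p r) (*-monoʳ-≤ (q ^ 2) q^k≤2p^k) ⟩
      weight p r * (q ^ 2 * (2 * p ^ k))    ≡⟨ regroup k (weight p r) (p ^ k) ⟩
      suc P * weight p r * p ^ k            ∎)) (patterns-weight p 2 k n)
      where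
      regroup : ∀ k w x → w * (suc (suc (2 * k)) * (suc (suc (2 * k)) * 1) * (2 * x))
                ≡ (8 + 8 * (2 * k + k * k)) * w * x
      regroup = solve-∀
    count : length (patterns 2 k n) < 2 ^ j
    count = begin-strict
      length (patterns 2 k n)                ≤⟨ length-patterns 2 k n ⟩
      suc (2 * n) ^ (2 + k)                  <⟨ ^-monoˡ-< (2 + k) 2n+1< ⟩
      (2 ^ (2 + ⌈log₂ n ⌉)) ^ (2 + k)        ≡⟨ ^-*-assoc 2 (2 + ⌈log₂ n ⌉) (2 + k) ⟩
      2 ^ ((2 + ⌈log₂ n ⌉) * (2 + k))        ≡⟨ cong (2 ^_) (*-comm (2 + ⌈log₂ n ⌉) (2 + k)) ⟩
      2 ^ j                                  ∎
      where
      l : ℕ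
      l = 2 ^ ⌈log₂ n ⌉
      2n+1< : suc (2 * n) < 2 * (2 * l)
      2n+1< = begin-strict
        suc (2 * n)         <⟨ ≤-refl ⟩
        2 + 2 * n           ≤⟨ +-mono-≤ (*-monoʳ-≤ 2 (m^n>0 2 ⌈log₂ n ⌉)) (*-monoʳ-≤ 2 (n≤2^⌈log₂n⌉ n)) ⟩
        2 * l + 2 * l       ≡⟨ four l ⟩
        2 * (2 * l)         ∎
        where
        four : ∀ l → 2 * l + 2 * l ≡ 2 * (2 * l)
        four = solve-∀
    -- Each block of `P` rounds halves the list, so `j` blocks exhaust fewer than 2^j patterns.
    few : length (patterns 2 k n) * P ^ (P * j) < suc P ^ (P * j)
    few = begin-strict
      length (patterns 2 k n) * P ^ (P * j)   <⟨ *-monoˡ-< (P ^ (P * j)) {{m^n≢0 P (P * j)}} count ⟩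
      2 ^ j * P ^ (P * j)                     ≡⟨ cong (2 ^ j *_) (^-*-assoc P P j) ⟨
      2 ^ j * (P ^ P) ^ j                     ≡⟨ *-^-distrib 2 (P ^ P) j ⟨
      (2 * P ^ P) ^ j                         ≤⟨ ^-monoˡ-≤ j (2p^p≤[1+p]^p P) ⟩
      (suc P ^ P) ^ j                         ≡⟨ ^-*-assoc (suc P) P j ⟩
      suc P ^ (P * j)                         ∎

-- Finite sets and walks

comprehension : {P : Fin n → Set} → (∀ i → Dec (P i)) → Subset n
comprehension P? = tabulate (does ∘ P?)

∈-comprehension⁺ : {P : Fin n → Set} (P? : ∀ i → Dec (P i)) {i : Fin n} → P i → i ∈ comprehension P?
∈-comprehension⁺ P? {i} p = lookup⇒[]= i _ (trans (lookup∘tabulate (does ∘ P?) i) (dec-true (P? i) p))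

∈-comprehension⁻ : {P : Fin n → Set} (P? : ∀ i → Dec (P i)) {i : Fin n} → i ∈ comprehension P? → P i
∈-comprehension⁻ P? {i} i∈ with P? i | trans (≡-sym (lookup∘tabulate (does ∘ P?) i)) ([]=⇒lookup i∈)
... | yes p | _ = p

least : {P : Fin n → Set} → (∀ i → Dec (P i)) → ∃ P → ∃[ i ] (P i × (∀ j → P j → toℕ i ≤ toℕ j))
least {suc n} P? (i , p) with P? zero
... | yes p₀ = zero , p₀ , λ _ _ → z≤n
least {suc n} P? (zero  , p) | no ¬p₀ = contradiction p ¬p₀
least {suc n} P? (suc i , p) | no ¬p₀ with least (P? ∘ suc) (i , p)
... | j , q , min = suc j , q , λ { zero p₀ → contradiction p₀ ¬p₀ ; (suc l) pl → s≤s (min l pl) }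

-- The image of `p` has at most `∣ p ∣` elements, so it is not all of `Fin m`.
freshValue : ∀ {m} (p : Subset n) (c : Fin n → Fin m) → ∣ p ∣ < m → ∃[ x ] (∀ {u} → u ∈ p → c u ≢ x)
freshValue {m = m} p c ∣p∣<m =
  let x , x∉ = ¬∀⟶∃¬ m (_∈ image p c) (_∈? image p c) notAll
  in x , λ {u} u∈p cu≡x → x∉ (subst (_∈ image p c) cu≡x (∈-image p c u∈p))
  where
  image : ∀ {n} → Subset n → (Fin n → Fin m) → Subset m
  image []          c = ⊥
  image (true ∷ p)  c = ⁅ c zero ⁆ ∪ image p (c ∘ suc)
  image (false ∷ p) c = image p (c ∘ suc)
  ∈-image : ∀ {n} (p : Subset n) c {u} → u ∈ p → c u ∈ image p c
  ∈-image (true ∷ p)  c here        = x∈p∪q⁺ (inj₁ (x∈⁅x⁆ _))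
  ∈-image (true ∷ p)  c (there u∈p) = x∈p∪q⁺ (inj₂ (∈-image p (c ∘ suc) u∈p))
  ∈-image (false ∷ p) c (there u∈p) = ∈-image p (c ∘ suc) u∈p
  ∣image∣≤ : ∀ {n} (p : Subset n) c → ∣ image p c ∣ ≤ ∣ p ∣
  ∣image∣≤ []          c = ≤-reflexive (∣⊥∣≡0 m)
  ∣image∣≤ (true ∷ p)  c = ≤-trans (∣p∪q∣≤∣p∣+∣q∣ ⁅ c zero ⁆ _)
    (+-mono-≤ (≤-reflexive (∣⁅x⁆∣≡1 (c zero))) (∣image∣≤ p (c ∘ suc)))
  ∣image∣≤ (false ∷ p) c = ∣image∣≤ p (c ∘ suc)
  notAll : ¬ (∀ x → x ∈ image p c)
  notAll all = <-irrefl refl (begin-strict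
    m              ≡⟨ ∣⊤∣≡n m ⟨
    ∣ ⊤ {m} ∣      ≤⟨ p⊆q⇒∣p∣≤∣q∣ {p = ⊤} (λ {x} _ → all x) ⟩
    ∣ image p c ∣  ≤⟨ ∣image∣≤ p c ⟩
    ∣ p ∣          <⟨ ∣p∣<m ⟩
    m              ∎)
    where open ≤-Reasoning

-- The rank counts the vertices of smaller key. It replaces the range `Fin N`, which will depend on
-- the hidden decomposition, by one depending on `n` only, so that orderings can be searched for.
ranking : ∀ {N} (key : Fin n → Fin N) →
          Σ (Fin n → Fin (suc n)) λ ρ → ∀ u v → key u Fin.< key v → ρ u Fin.< ρ v
ranking {n} key = ρ , ρ-mono
  where
  below? : ∀ v u → Dec (key u Fin.< key v)
  below? v u = key u Fin.<? key v
  below : Fin n → Subset n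
  below v = comprehension (below? v)
  ρ : Fin n → Fin (suc n)
  ρ v = fromℕ< (s≤s (∣p∣≤n (below v)))
  toℕ-ρ : ∀ v → toℕ (ρ v) ≡ ∣ below v ∣
  toℕ-ρ v = toℕ-fromℕ< (s≤s (∣p∣≤n (below v)))
  ρ-mono : ∀ u v → key u Fin.< key v → ρ u Fin.< ρ v
  ρ-mono u v u<v rewrite toℕ-ρ u | toℕ-ρ v = p⊂q⇒∣p∣<∣q∣
    ( (λ w∈ → ∈-comprehension⁺ (below? v) (<-trans (∈-comprehension⁻ (below? u) w∈) u<v))
    , u , ∈-comprehension⁺ (below? v) u<v , λ u∈ → <-irrefl refl (∈-comprehension⁻ (below? u) u∈))

module _ {A : Set} {R : A → A → Set} {P : A → Set} where

  walk-start : ∀ {a b} → Walk R P a b → P a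
  walk-start (here p)     = p
  walk-start (step p _ _) = p

  walk-sym : ∀ {a b} → Walk R P a b → Walk R P b a
  walk-sym w = go w (here (walk-start w))
    where
    go : ∀ {a b c} → Walk R P a b → Walk R P a c → Walk R P b c
    go (here _)     back = back
    go (step _ e w) back = go w (step (walk-start w) (swap e) back)

-- In two colour classes every vertex has at most one earlier neighbour, so they
-- span a forest.
record Elimination (R : Fin n → Fin n → Set) (ρ : Fin n → Fin (suc n)) (c : Fin n → Fin (suc k)) : Set where
  field
    ρ-injective : ∀ u v → ρ u ≡ ρ v → u ≡ v
    proper      : ∀ u v → ρ u Fin.< ρ v → R u v → c u ≢ c v
    unique      : ∀ u u′ v → ρ u Fin.< ρ v → ρ u′ Fin.< ρ v → R u v → R u′ v → c u ≡ c u′ → u ≡ u′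

-- Tree decompositions

module _ {G : Graph n} (D : TreeDecomp G) where

  private
    T = tree D
    Node = Fin (suc (size-1 T))

  data Descendant (a : Node) : Node → Set where
    root  : Descendant a a
    child : ∀ {i} → Descendant a (parent T i) → Descendant a (suc i)

  descendant-≥ : ∀ {a t} → Descendant a t → toℕ a ≤ toℕ t
  descendant-≥ root            = ≤-refl
  descendant-≥ (child {i} d)   = ≤-trans (descendant-≥ d) (m≤n⇒m≤1+n (parent< T i))

  -- A walk can leave the subtree at a only through the edge from a to its parent.
  leave : ∀ {P : Node → Set} {a s t} → Descendant a s → Walk (TEdge T) P s t →
          Descendant a t ⊎ (P a × ∃[ i ] (a ≡ suc i × P (parent T i)))
  leave d         (here _)                            = inj₁ d
  leave root      (step p (inj₁ (i , refl , refl)) w) = inj₂ (p , i , refl , walk-start w)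
  leave (child d) (step p (inj₁ (i , refl , refl)) w) = leave d w
  leave d         (step p (inj₂ (i , refl , eq)) w)   = leave (child (subst (Descendant _) (≡-sym eq) d)) w

  ShareBag : Fin n → Fin n → Set
  ShareBag u v = ∃[ t ] (u ∈ bag D t × v ∈ bag D t)

  private
    leastBag : ∀ v → ∃[ t ] (v ∈ bag D t × (∀ s → v ∈ bag D s → toℕ t ≤ toℕ s))
    leastBag v = least (λ t → v ∈? bag D t) (cover D v)

  -- The root of the subtree formed by the bags containing `v`: parents have smaller indices, so it
  -- is the node of least index.
  top : Fin n → Node
  top v = proj₁ (leastBag v)

  top-∈ : ∀ v → v ∈ bag D (top v)
  top-∈ v = proj₁ (proj₂ (leastBag v))

  top-≤ : ∀ v t → v ∈ bag D t → toℕ (top v) ≤ toℕ t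
  top-≤ v = proj₂ (proj₂ (leastBag v))

  top-parent : ∀ {v i} → top v ≡ suc i → v ∉ bag D (parent T i)
  top-parent {v} {i} eq v∈ = <-irrefl refl (begin-strict
    toℕ i               <⟨ ≤-refl ⟩
    toℕ (Fin.suc i)     ≡⟨ cong toℕ eq ⟨
    toℕ (top v)         ≤⟨ top-≤ v _ v∈ ⟩
    toℕ (parent T i)    ≤⟨ parent< T i ⟩
    toℕ i               ∎)
    where open ≤-Reasoning

  -- A walk leaving the subtree at `top v` inside the bags of `v` would put `v` into the parent's
  -- bag, against minimality.
  below-top : ∀ {v t} → v ∈ bag D t → Descendant (top v) t
  below-top {v} {t} v∈ with leave root (subtree D v (top v) t (top-∈ v) v∈)
  ... | inj₁ d                   = d
  ... | inj₂ (_ , i , eq , v∈pa) = contradiction v∈pa (top-parent eq)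

  -- The common bag lies below `top v`. Walking from it to `top u` through bags of `u` either leaves
  -- through `top v` or stays below it, which forces `top u` and `top v` to coincide.
  earlier-∈ : ∀ {u v} → ShareBag u v → toℕ (top u) ≤ toℕ (top v) → u ∈ bag D (top v)
  earlier-∈ {u} {v} (t , u∈ , v∈) u≤v with leave (below-top v∈) (subtree D u t (top u) u∈ (top-∈ u))
  ... | inj₁ d         = subst (λ s → u ∈ bag D s) (toℕ-injective (≤-antisym u≤v (descendant-≥ d))) (top-∈ u)
  ... | inj₂ (u∈a , _) = u∈a

  Separator : ℕ → Fin n → Fin n → Set
  Separator k u v = ∃[ X ] (∣ X ∣ ≤ k × u ∉ X × v ∉ X ×
    (∀ S → (∀ {w} → w ∈ X → w ∉ S) → ¬ ConnIn G S u v))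

  module _ (small : BagsAtMost D (suc k)) where

    separator-< : ∀ {u v} → ¬ ShareBag u v → toℕ (top v) < toℕ (top u) → Separator k u v
    separator-< {u} {v} ¬share v<u with top u in eq
    ... | suc i = X , X≤k , u∉X , v∉X , λ S avoid w →
        <⇒≱ v<u (descendant-≥ (inside-walk avoid w inside-u (top v) (top-∈ v)))
      where
      -- `top u` is not the root, as `top v` has a smaller index. Since `u` is in this bag but not
      -- in its parent's, the intersection has at most `k` elements.
      X = bag D (suc i) ∩ bag D (parent T i)
      u∈ : u ∈ bag D (suc i)
      u∈ = subst (λ s → u ∈ bag D s) eq (top-∈ u)
      u∉X : u ∉ X
      u∉X u∈X = top-parent eq (proj₂ (x∈p∩q⁻ _ _ u∈X))
      v∉X : v ∉ X
      v∉X v∈X = ¬share (_ , u∈ , proj₁ (x∈p∩q⁻ _ _ v∈X))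
      X≤k : ∣ X ∣ ≤ k
      X≤k = s≤s⁻¹ (≤-trans (p⊂q⇒∣p∣<∣q∣ (p∩q⊆p _ _ , u , u∈ , u∉X)) (small (suc i)))
      Inside : Fin n → Set
      Inside w = ∀ t → w ∈ bag D t → Descendant (suc i) t
      inside-u : Inside u
      inside-u t u∈t = subst (λ s → Descendant s t) eq (below-top u∈t)
      -- If `y` also had a bag outside the subtree, its walk there would cross the edge to the
      -- parent and `y` would lie in `X`.
      inside-edge : ∀ {x y} → Inside x → y ∉ X → ShareBag x y → Inside y
      inside-edge {x} {y} inside-x y∉X (t , x∈t , y∈t) s y∈s
        with leave (inside-x t x∈t) (subtree D y t s y∈t y∈s)
      ... | inj₁ d                       = d
      ... | inj₂ (y∈a , _ , refl , y∈pa) = contradiction (x∈p∩q⁺ (y∈a , y∈pa)) y∉X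
      share : ∀ {x y} → Edge G x y ⊎ Edge G y x → ShareBag x y
      share (inj₁ e) = edgeCover D _ _ e
      share (inj₂ e) = let t , y∈ , x∈ = edgeCover D _ _ e in t , x∈ , y∈
      inside-walk : ∀ {S x y} → (∀ {w} → w ∈ X → w ∉ S) → ConnIn G S x y → Inside x → Inside y
      inside-walk avoid (here _)     inside = inside
      inside-walk avoid (step _ e w) inside =
        inside-walk avoid w (inside-edge inside (λ y∈X → avoid y∈X (walk-start w)) (share e))

    separator : ∀ {u v} → ¬ ShareBag u v → Separator k u v
    separator {u} {v} ¬share with <-cmp (toℕ (top u)) (toℕ (top v))
    ... | tri> _ _ v<u = separator-< ¬share v<u
    ... | tri≈ _ eq _ = contradiction
      (top u , top-∈ u , subst (λ s → v ∈ bag D s) (≡-sym (toℕ-injective eq)) (top-∈ v)) ¬share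
    ... | tri< u<v _ _ =
      let X , X≤k , v∉X , u∉X , sep = separator-< (λ { (t , v∈ , u∈) → ¬share (t , u∈ , v∈) }) u<v
      in X , X≤k , u∉X , v∉X , λ S avoid w → sep S avoid (walk-sym w)

    -- Order the vertices by `top`. By `earlier-∈`, the earlier vertices sharing a bag with `v` all
    -- lie in the bag at `top v`, which has room for `k` others, so greedy colouring succeeds with
    -- `suc k` colours.
    elimination : ∃[ ρ ] ∃[ c ] Elimination {k = k} ShareBag ρ c
    elimination = ρ , c , record
      { ρ-injective = ρ-inj
      ; proper      = λ u v u<v sh → good u v u<v (toℕ<n (ρ v)) (earlier-∈ sh (ρ<⇒top≤ u v u<v))
      ; unique      = λ u u′ v u<v u′<v sh sh′ cu≡cu′ →
          distinct u u′ (earlier-∈ sh (ρ<⇒top≤ u v u<v)) (earlier-∈ sh′ (ρ<⇒top≤ u′ v u′<v)) cu≡cu′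
      }
      where
      -- Lexicographic; the second component breaks ties and makes the ranking injective.
      key : Fin n → Fin (suc (size-1 T) * n)
      key v = combine (top v) v
      ρ : Fin n → Fin (suc n)
      ρ = proj₁ (ranking key)
      ρ-mono : ∀ u v → key u Fin.< key v → ρ u Fin.< ρ v
      ρ-mono = proj₂ (ranking key)
      ρ-inj : ∀ u v → ρ u ≡ ρ v → u ≡ v
      ρ-inj u v eq with Fin.<-cmp (key u) (key v)
      ... | tri< u<v _ _ = contradiction (cong toℕ eq) (<⇒≢ (ρ-mono u v u<v))
      ... | tri≈ _ e _   = combine-injectiveʳ (top u) u (top v) v e
      ... | tri> _ _ v<u = contradiction (cong toℕ eq) (>⇒≢ (ρ-mono v u v<u))
      ρ<⇒top≤ : ∀ u v → ρ u Fin.< ρ v → toℕ (top u) ≤ toℕ (top v)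
      ρ<⇒top≤ u v u<v =
        ≮⇒≥ (λ top< → <-asym u<v (ρ-mono v u (combine-monoˡ-< v u top<)))

      Good : ℕ → (Fin n → Fin (suc k)) → Set
      Good j c = ∀ u v → ρ u Fin.< ρ v → toℕ (ρ v) < j → u ∈ bag D (top v) → c u ≢ c v

      colour : ∀ j → ∃[ c ] Good j c
      -- A placeholder colour: no vertex has rank below 0.
      colour zero = (λ _ → zero) , λ _ _ _ ()
      colour (suc j) with colour j | any? (λ v → toℕ (ρ v) ≟ j)
      ... | c , good | no none = c , λ u v u<v v≤j →
          good u v u<v (≤∧≢⇒< (s≤s⁻¹ v≤j) (λ eq → none (v , eq)))
      ... | c , good | yes (v₀ , refl) = c′ , good′
        where
        others = bag D (top v₀) - v₀
        fresh = freshValue others c (<-≤-trans (x∈p⇒∣p-x∣<∣p∣ (top-∈ v₀)) (small (top v₀)))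
        c′ : Fin n → Fin (suc k)
        c′ w = if does (w Fin.≟ v₀) then proj₁ fresh else c w
        good′ : Good (suc (toℕ (ρ v₀))) c′
        good′ u v u<v v≤j u∈ with u Fin.≟ v₀ | v Fin.≟ v₀
        ... | yes refl | yes refl = contradiction u<v (<-irrefl refl)
        -- Recolouring `v₀` affects only later vertices, whose ranks are outside the invariant.
        ... | yes refl | no v≢v₀  = contradiction (s≤s⁻¹ v≤j) (<⇒≱ u<v)
        ... | no u≢v₀  | yes refl = proj₂ fresh (x∈p∧x≢y⇒x∈p-y u∈ u≢v₀)
        ... | no u≢v₀  | no v≢v₀  =
          good u v u<v (≤∧≢⇒< (s≤s⁻¹ v≤j) (λ eq → v≢v₀ (ρ-inj v v₀ (toℕ-injective eq)))) u∈

      c : Fin n → Fin (suc k)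
      c = proj₁ (colour (suc n))
      good : Good (suc n) c
      good = proj₂ (colour (suc n))

      -- Whichever of the two comes first lies in the top bag of the other, where `good` applies.
      distinct : ∀ u u′ {t} → u ∈ bag D t → u′ ∈ bag D t → c u ≡ c u′ → u ≡ u′
      distinct u u′ u∈ u′∈ eq with Fin.<-cmp (ρ u) (ρ u′)
      ... | tri< u<u′ _ _ = contradiction eq
        (good u u′ u<u′ (toℕ<n (ρ u′)) (earlier-∈ (_ , u∈ , u′∈) (ρ<⇒top≤ u u′ u<u′)))
      ... | tri≈ _ e _    = ρ-inj u u′ e
      ... | tri> _ _ u′<u = contradiction (≡-sym eq)
        (good u′ u u′<u (toℕ<n (ρ u)) (earlier-∈ (_ , u′∈ , u∈) (ρ<⇒top≤ u′ u u′<u)))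

-- Connectivity and the oracle

module _ (G : Graph n) where

  Edge-sym : ∀ {u v} → Edge G u v → Edge G v u
  Edge-sym {u} {v} e = trans (sym G v u) e

  Edge-either : ∀ {u v} → Edge G u v ⊎ Edge G v u → Edge G u v
  Edge-either = [ id , Edge-sym ]

  ConnIn-mono : ∀ {S S′} → (∀ {w} → w ∈ S → w ∈ S′) → ∀ {u v} → ConnIn G S u v → ConnIn G S′ u v
  ConnIn-mono S⊆S′ (here p)     = here (S⊆S′ p)
  ConnIn-mono S⊆S′ (step p e w) = step (S⊆S′ p) e (ConnIn-mono S⊆S′ w)

  -- The part of the walk after its last visit to `u` survives the removal of `u`; this is the
  -- reduction behind `connected?`.
  lastVisit : ∀ {S} u {a v} → u ≢ v → ConnIn G S a v →
              ConnIn G (S - u) a v ⊎ ∃[ w ] (Edge G u w × ConnIn G (S - u) w v)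
  lastVisit u u≢v (here p) = inj₁ (here (x∈p∧x≢y⇒x∈p-y p (u≢v ∘ ≡-sym)))
  lastVisit u {a} u≢v (step {b = b} p e w) with lastVisit u u≢v w | a Fin.≟ u
  ... | inj₂ found | _        = inj₂ found
  ... | inj₁ w′    | yes refl = inj₂ (b , Edge-either e , w′)
  ... | inj₁ w′    | no a≢u   = inj₁ (step (x∈p∧x≢y⇒x∈p-y p a≢u) e w′)

  connected? : ∀ S u v → Dec (ConnIn G S u v)
  connected? S = go n S (∣p∣≤n S)
    where
    go : ∀ m S → ∣ S ∣ ≤ m → ∀ u v → Dec (ConnIn G S u v)
    go m S ∣S∣≤m u v with u ∈? S | u Fin.≟ v
    ... | no u∉S  | _        = no (u∉S ∘ walk-start)
    ... | yes u∈S | yes refl = yes (here u∈S)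
    go zero    S ∣S∣≤m u v | yes u∈S | no u≢v =
      contradiction (<-≤-trans (x∈p⇒∣p-x∣<∣p∣ u∈S) ∣S∣≤m) λ ()
    go (suc m) S ∣S∣≤m u v | yes u∈S | no u≢v =
      map′ (λ (w , e , walk) → step u∈S (inj₁ e) (ConnIn-mono (p─q⊆p S _) walk)) onward
        (any? λ w → (adj G u w Bool.≟ true) ×-dec
          go m (S - u) (s≤s⁻¹ (<-≤-trans (x∈p⇒∣p-x∣<∣p∣ u∈S) ∣S∣≤m)) w v)
      where
      onward : ConnIn G S u v → ∃[ w ] (Edge G u w × ConnIn G (S - u) w v)
      onward (here _)     = contradiction refl u≢v
      onward (step _ e w) = [ (λ w′ → _ , Edge-either e , w′) , id ] (lastVisit u u≢v w)

  answer : ∀ S → ∃[ ans ] CorrectCC G S ans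
  answer S = (λ u v → does (block? u v)) , λ u v → correct (block? u v)
    where
    block? : ∀ u v → Dec (u ∈ S × v ∈ S × ConnIn G S u v)
    block? u v = (u ∈? S) ×-dec (v ∈? S) ×-dec connected? S u v
    correct : ∀ {A : Set} (d : Dec A) → (does d ≡ true) ⇔ A
    correct (yes a) = mk⇔ (λ _ → a) (λ _ → refl)
    correct (no ¬a) = mk⇔ (λ ()) (λ a → contradiction a ¬a)

  -- Decidable connectivity supplies a correct answer to every query, so statements about all runs
  -- are not vacuous.
  run : ∀ A → ∃[ q ] ∃[ E ] Run G A q E
  run (output E)  = 0 , E , done
  run (query S f) =
    let ans , correct = answer S
        q , E , r     = run (f ans)
    in suc q , E , ask correct r

-- Batches of queries

Transcript : ℕ → Set
Transcript n = List (Subset n × Answer n)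

batch : List (Subset n) → (Transcript n → Alg n) → Alg n
batch []       f = f []
batch (S ∷ Ss) f = query S λ ans → batch Ss λ t → f ((S , ans) ∷ t)

-- For the first transcript this is the graph `H` of pairs that no query splits.
Consistent : Transcript n → Fin n → Fin n → Set
Consistent t u v = All (λ (S , ans) → u ∈ S → v ∈ S → ans u v ≡ true) t

consistent? : ∀ (t : Transcript n) u v → Dec (Consistent t u v)
consistent? t u v = All.all? (λ (S , ans) → (u ∈? S) →-dec (v ∈? S) →-dec (ans u v Bool.≟ true)) t

module _ (G : Graph n) where

  Correct : Transcript n → Set
  Correct = All λ (S , ans) → CorrectCC G S ans

  run-batch : ∀ Ss {f q E} → Run G (batch Ss f) q E →
              ∃[ t ] ∃[ q′ ] (map proj₁ t ≡ Ss × Correct t × q ≡ length Ss + q′ × Run G (f t) q′ E)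
  run-batch []       r         = [] , _ , refl , [] , refl , r
  run-batch (S ∷ Ss) (ask c r) =
    let t , q′ , queries , correct , q≡ , r′ = run-batch Ss r
    in _ ∷ t , q′ , cong (S ∷_) queries , c ∷ correct , cong suc q≡ , r′

  edge-consistent : ∀ {t u v} → Correct t → Edge G u v → Consistent t u v
  edge-consistent {u = u} {v} correct e = All.map
    (λ c u∈ v∈ → Equivalence.from (c u v) (u∈ , v∈ , step u∈ (inj₁ e) (here v∈))) correct

  consistent-connected : ∀ {P : Subset n → Set} {t u v} → Correct t → Consistent t u v →
                         Any P (map proj₁ t) → ∃[ S ] (P S × (u ∈ S → v ∈ S → ConnIn G S u v))
  consistent-connected (c ∷ _)       (h ∷ _)    (here p)  =
    _ , p , λ u∈ v∈ → proj₂ (proj₂ (Equivalence.to (c _ _) (h u∈ v∈)))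
  consistent-connected (_ ∷ correct) (_ ∷ cons) (there p) = consistent-connected correct cons p

-- Reading off the edges on two colour classes

-- Serves to pass from `ShareBag` to `Consistent`, and to coded functions, which `finToFun` recovers
-- only pointwise.
elimination-map : ∀ {R R′ : Fin n → Fin n → Set} {ρ ρ′} {c c′ : Fin n → Fin (suc k)} →
                  (∀ u v → R′ u v → R u v) → (∀ v → ρ′ v ≡ ρ v) → (∀ v → c′ v ≡ c v) →
                  Elimination R ρ c → Elimination R′ ρ′ c′
elimination-map {ρ = ρ} {ρ′} {c} {c′} R′⊆R ρ≗ c≗ el = record
  { ρ-injective = λ u v eq → ρ-injective u v (trans (≡-sym (ρ≗ u)) (trans eq (ρ≗ v)))
  ; proper      = λ u v u<v r → subst₂ _≢_ (≡-sym (c≗ u)) (≡-sym (c≗ v)) (proper u v (ρ-< u<v) (R′⊆R u v r))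
  ; unique      = λ u u′ v u<v u′<v r r′ eq →
      unique u u′ v (ρ-< u<v) (ρ-< u′<v) (R′⊆R u v r) (R′⊆R u′ v r′) (trans (≡-sym (c≗ u)) (trans eq (c≗ u′)))
  }
  where
  open Elimination el
  ρ-< : ∀ {u v} → ρ′ u Fin.< ρ′ v → ρ u Fin.< ρ v
  ρ-< {u} {v} = subst₂ Fin._<_ (ρ≗ u) (ρ≗ v)

elimination? : ∀ {R : Fin n → Fin n → Set} → (∀ u v → Dec (R u v)) →
               ∀ ρ (c : Fin n → Fin (suc k)) → Dec (Elimination R ρ c)
elimination? R? ρ c = map′
  (λ (i , p , u) → record { ρ-injective = i ; proper = p ; unique = u })
  (λ el → let open Elimination el in ρ-injective , proper , unique)
  ( (all? λ u → all? λ v → (ρ u Fin.≟ ρ v) →-dec (u Fin.≟ v))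
  ×-dec (all? λ u → all? λ v → (ρ u Fin.<? ρ v) →-dec R? u v →-dec ¬? (c u Fin.≟ c v))
  ×-dec (all? λ u → all? λ u′ → all? λ v →
    (ρ u Fin.<? ρ v) →-dec (ρ u′ Fin.<? ρ v) →-dec R? u v →-dec R? u′ v →-dec
    (c u Fin.≟ c u′) →-dec (u Fin.≟ u′)))

pigeonhole₂ : ∀ {A : Set} {p q x y z : A} → x ≡ p ⊎ x ≡ q → y ≡ p ⊎ y ≡ q → z ≡ p ⊎ z ≡ q →
              x ≢ z → y ≢ z → x ≡ y
pigeonhole₂ (inj₁ refl) (inj₁ refl) _           _   _   = refl
pigeonhole₂ (inj₂ refl) (inj₂ refl) _           _   _   = refl
pigeonhole₂ (inj₁ refl) (inj₂ refl) (inj₁ refl) x≢z _   = contradiction refl x≢z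
pigeonhole₂ (inj₁ refl) (inj₂ refl) (inj₂ refl) _   y≢z = contradiction refl y≢z
pigeonhole₂ (inj₂ refl) (inj₁ refl) (inj₁ refl) _   y≢z = contradiction refl y≢z
pigeonhole₂ (inj₂ refl) (inj₁ refl) (inj₂ refl) x≢z _   = contradiction refl x≢z

module _ {G : Graph n} {R : Fin n → Fin n → Set} (G⊆R : ∀ {u v} → Edge G u v → R u v)
         {ρ} {c : Fin n → Fin (suc k)} (el : Elimination R ρ c)
         {S : Subset n} {p q} (two : ∀ {w} → w ∈ S → c w ≡ p ⊎ c w ≡ q) where

  open Elimination el

  -- Both earlier neighbours have the one colour of `p`, `q` that `x` does not have.
  earlier-unique : ∀ {y y′ x} → y ∈ S → y′ ∈ S → x ∈ S → ρ y Fin.< ρ x → ρ y′ Fin.< ρ x →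
                   R y x → R y′ x → y ≡ y′
  earlier-unique y∈ y′∈ x∈ y<x y′<x r r′ = unique _ _ _ y<x y′<x r r′
    (pigeonhole₂ (two y∈) (two y′∈) (two x∈) (proper _ _ y<x r) (proper _ _ y′<x r′))

  -- The upward path from `v` is recorded so that `descend` can retrace it.
  data Ascends (v : Fin n) : Fin n → Set where
    start : v ∈ S → Ascends v v
    up    : ∀ {x y} → Ascends v x → Edge G x y → ρ x Fin.< ρ y → y ∈ S → Ascends v y

  ascends-∈ : ∀ {v x} → Ascends v x → x ∈ S
  ascends-∈ (start v∈)    = v∈
  ascends-∈ (up _ _ _ y∈) = y∈

  ascends-≥ : ∀ {v x} → Ascends v x → ρ v Fin.≤ ρ x
  ascends-≥ (start _)      = ≤-refl
  ascends-≥ (up a _ x<y _) = ≤-trans (ascends-≥ a) (<⇒≤ x<y)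

  -- The vertices above v can only be left downwards from v itself, and u is
  -- the only earlier R-neighbour of v in S.
  descend : ∀ {u v x} → u ∈ S → R u v → ρ u Fin.< ρ v → Ascends v x → ConnIn G S x u → Edge G u v
  descend u∈ r u<v a (here _) = contradiction u<v (≤⇒≯ (ascends-≥ a))
  descend {x = x} u∈ r u<v a (step {b = y} x∈ e w) with Fin.<-cmp (ρ x) (ρ y)
  ... | tri< x<y _ _ = descend u∈ r u<v (up a (Edge-either G e) x<y (walk-start w)) w
  ... | tri≈ _ eq _ with refl ← ρ-injective x y eq =
    contradiction (trans (≡-sym (Edge-either G e)) (irrefl G x)) λ ()
  descend u∈ r u<v (start v∈) (step x∈ e w) | tri> _ _ y<x
    with refl ← earlier-unique (walk-start w) u∈ v∈ y<x u<v (G⊆R (Edge-sym G (Edge-either G e))) r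
    = Edge-sym G (Edge-either G e)
  -- A downward step must return to the vertex from which the ascent last came, so the ascent gets
  -- shorter.
  descend u∈ r u<v (up a e′ x′<x _) (step x∈ e w) | tri> _ _ y<x
    with refl ← earlier-unique (walk-start w) (ascends-∈ a) x∈ y<x x′<x
                  (G⊆R (Edge-sym G (Edge-either G e))) (G⊆R e′)
    = descend u∈ r u<v a w

  connected-edge : ∀ {u v} → u ≢ v → R u v → R v u → ConnIn G S u v → Edge G u v
  connected-edge {u} {v} u≢v r r′ w with Fin.<-cmp (ρ u) (ρ v)
  ... | tri< u<v _ _ = descend (walk-start w) r u<v (start (walk-start (walk-sym w))) (walk-sym w)
  ... | tri≈ _ eq _  = contradiction (ρ-injective u v eq) u≢v
  ... | tri> _ _ v<u = Edge-sym G (descend (walk-start (walk-sym w)) r′ v<u (start (walk-start w)) w)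

-- The algorithm

length-cartesianProductWith : ∀ {A B C : Set} (f : A → B → C) xs ys →
                              length (cartesianProductWith f xs ys) ≡ length xs * length ys
length-cartesianProductWith f []       ys = refl
length-cartesianProductWith f (x ∷ xs) ys =
  trans (length-++ (map (f x) ys)) (cong₂ _+_ (length-map (f x) ys) (length-cartesianProductWith f xs ys))

module _ (c : Fin n → Fin (suc k)) where

  twoColours? : ∀ x y w → Dec (c w ≡ x ⊎ c w ≡ y)
  twoColours? x y w = (c w Fin.≟ x) ⊎-dec (c w Fin.≟ y)

  twoColours : Fin (suc k) → Fin (suc k) → Subset n
  twoColours x y = comprehension (twoColours? x y)

  colourPairs : List (Subset n)
  colourPairs = cartesianProductWith twoColours (allFin (suc k)) (allFin (suc k))

  length-colourPairs : length colourPairs ≡ suc k * suc k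
  length-colourPairs = trans (length-cartesianProductWith twoColours (allFin (suc k)) (allFin (suc k)))
    (cong₂ _*_ (length-tabulate {n = suc k} id) (length-tabulate {n = suc k} id))

-- The decomposition is hidden, so any ordering and colouring that suit `H` are searched for. Coding
-- them as numbers makes the search finite, and it costs no queries.
Certificate : ∀ k → Transcript n → Set
Certificate {n} k t = ∃[ i ] ∃[ j ] Elimination {n} {k} (Consistent t) (finToFun i) (finToFun j)

certificate? : ∀ k (t : Transcript n) → Dec (Certificate k t)
certificate? k t = any? λ i → any? λ j → elimination? (consistent? t) (finToFun i) (finToFun j)

-- Both orders of `u` and `v` are checked in the first transcript because `connected-edge` takes the
-- relation in both directions.
Accepted : Transcript n → Transcript n → Fin n → Fin n → Set
Accepted t t′ u v = u ≢ v × Consistent t u v × Consistent t v u × Consistent t′ u v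

accepted? : ∀ (t t′ : Transcript n) u v → Dec (Accepted t t′ u v)
accepted? t t′ u v = ¬? (u Fin.≟ v) ×-dec consistent? t u v ×-dec consistent? t v u ×-dec consistent? t′ u v

acceptedEdges : Transcript n → Transcript n → Fin n → Fin n → Bool
acceptedEdges t t′ u v = does (accepted? t t′ u v)

secondRound : ∀ (t : Transcript n) → Dec (Certificate k t) → Alg n
secondRound t (yes (i , j , _)) = batch (colourPairs (finToFun j)) λ t′ → output (acceptedEdges t t′)
-- An arbitrary output: `certificate` rules this case out for hidden graphs with a width-k
-- decomposition.
secondRound t (no _)            = output λ _ _ → false

reconstruct : ∀ n k → Alg n
reconstruct n k = batch (proj₁ (separatingFamily n k)) λ t → secondRound t (certificate? k t)

-- Correctness and the number of queries

module _ {G : Graph n} (D : TreeDecomp G) (small : BagsAtMost D (suc k)) {t : Transcript n}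
         (queries : map proj₁ t ≡ proj₁ (separatingFamily n k)) (correct : Correct G t) where

  -- Without a common bag, some query contains both vertices and misses their separator, so its
  -- answer splits them.
  consistent⇒shareBag : ∀ u v → Consistent t u v → ShareBag D u v
  consistent⇒shareBag u v cons with any? (λ s → (u ∈? bag D s) ×-dec (v ∈? bag D s))
  ... | yes share = share
  ... | no ¬share =
    let X , X≤k , u∉X , v∉X , sep = separator D small ¬share
        covers = proj₂ (proj₂ (separatingFamily n k)) u v X u∉X v∉X X≤k
        S , (u∈S , v∈S , avoid) , conn =
          consistent-connected G correct cons (subst (Any _) (≡-sym queries) covers)
    in contradiction (conn u∈S v∈S) (sep S avoid)

  certificate : Certificate k t
  certificate = let ρ , c , el = elimination D small in
    funToFin ρ , funToFin c ,
    elimination-map consistent⇒shareBag (finToFun-funToFin ρ) (finToFun-funToFin c) el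

-- The query on the colours of `u` and `v` contains both and was not split, so they are connected
-- within two colour classes.
accepted-edge : ∀ {G : Graph n} {t t′} {ρ} {c : Fin n → Fin (suc k)} → Correct G t → Correct G t′ →
                Elimination (Consistent t) ρ c → map proj₁ t′ ≡ colourPairs c →
                ∀ {u v} → Accepted t t′ u v → Edge G u v
accepted-edge {G = G} {t = t} {c = c} correct correct′ el queries {u} {v} (u≢v , uv , vu , uv′) =
  let S , S≡ , conn = consistent-connected G correct′ uv′ (subst (Any (twoColours c (c u) (c v) ≡_)) (≡-sym queries)
        (∈-cartesianProductWith⁺ (twoColours c) (∈-allFin (c u)) (∈-allFin (c v))))
      in∈ : ∀ w → c w ≡ c u ⊎ c w ≡ c v → w ∈ S
      in∈ w h = subst (w ∈_) S≡ (∈-comprehension⁺ (twoColours? c (c u) (c v)) h)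
  in connected-edge {G = G} {R = Consistent t} (edge-consistent G correct) el
       (λ {w} w∈ → ∈-comprehension⁻ (twoColours? c (c u) (c v)) (subst (w ∈_) (≡-sym S≡) w∈))
       u≢v uv vu (conn (in∈ u (inj₁ refl)) (in∈ v (inj₂ refl)))

edge-accepted : ∀ {G : Graph n} {t t′} → Correct G t → Correct G t′ →
                ∀ {u v} → Edge G u v → Accepted t t′ u v
edge-accepted {G = G} correct correct′ {u} {v} e =
  u≢v , edge-consistent G correct e , edge-consistent G correct (Edge-sym G e) , edge-consistent G correct′ e
  where
  u≢v : u ≢ v
  u≢v refl = contradiction (trans (≡-sym e) (irrefl G u)) λ ()

does≡ : ∀ {A : Set} (d : Dec A) {b} → (A → b ≡ true) → (b ≡ true → A) → does d ≡ b
does≡ (yes a) {b}     to from = ≡-sym (to a)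
does≡ (no ¬a) {false} to from = refl
does≡ (no ¬a) {true}  to from = contradiction (from refl) ¬a

queries-bound : ∀ n k {q} → q ≤ 8 * (suc k * suc k) * ((2 + k) * (2 + ⌈log₂ n ⌉)) →
                q + suc k * suc k ≤ Bound 33 k n
queries-bound n k {q} q≤ = begin
  q + suc k * suc k
    ≤⟨ +-monoˡ-≤ (suc k * suc k) q≤ ⟩
  8 * (suc k * suc k) * ((2 + k) * (2 + l)) + suc k * suc k
    ≤⟨ m≤m+n _ _ ⟩
  8 * (suc k * suc k) * ((2 + k) * (2 + l)) + suc k * suc k + suc k * suc k * slack k l
    ≡⟨ slack-≡ k l ⟩
  Bound 33 k n  ∎
  where
  open ≤-Reasoning
  l = ⌈log₂ n ⌉
  slack : ℕ → ℕ → ℕ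
  -- Up to the factor (k+1)², the bound is 33(k+1)(l+1) and the count 8(k+2)(l+2) + 1; the constant
  -- terms agree at 33 and this is the difference.
  slack k l = 25 * (k * l) + 17 * k + 17 * l
  slack-≡ : ∀ k l → 8 * (suc k * suc k) * ((2 + k) * (2 + l)) + suc k * suc k
              + suc k * suc k * (25 * (k * l) + 17 * k + 17 * l)
            ≡ 33 * (suc k * (suc k * (suc k * 1))) * suc l
  slack-≡ = solve-∀

secondRound-sound : ∀ {G : Graph n} (D : TreeDecomp G) → BagsAtMost D (suc k) →
                    ∀ {t} → map proj₁ t ≡ proj₁ (separatingFamily n k) → Correct G t →
                    ∀ (d : Dec (Certificate k t)) {q E} → Run G (secondRound t d) q E →
                    SameEdges E G × q ≡ suc k * suc k
secondRound-sound D small queries correct (no ¬cert) r =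
  contradiction (certificate D small queries correct) ¬cert
secondRound-sound {n} {k} {G} D small {t} queries correct (yes (i , j , el)) r
  with t′ , _ , queries′ , correct′ , refl , done ←
    run-batch G (colourPairs (finToFun j)) {λ t′ → output (acceptedEdges t t′)} r =
  (λ u v → does≡ (accepted? t t′ u v)
    (accepted-edge {G = G} {c = c} correct correct′ el queries′) (edge-accepted {G = G} correct correct′)) ,
  trans (+-identityʳ _) (length-colourPairs c)
  where
  c : Fin n → Fin (suc k)
  c = finToFun j

reconstruct-sound : ∀ n k {G : Graph n} (D : TreeDecomp G) → BagsAtMost D (suc k) →
                    ∀ {q E} → Run G (reconstruct n k) q E → SameEdges E G × q ≤ Bound 33 k n
reconstruct-sound n k {G} D small r =
  let t , q′ , queries , correct , q≡ , r′ = run-batch G (proj₁ (separatingFamily n k)) r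
      same , q′≡ = secondRound-sound D small queries correct (certificate? k t) r′
  in same , ≤-trans (≤-reflexive (trans q≡ (cong (length (proj₁ (separatingFamily n k)) +_) q′≡)))
       (queries-bound n k (proj₁ (proj₂ (separatingFamily n k))))

theorem6 : ∃[ C ] Σ ((n k : ℕ) → Alg n) λ A →
    ∀ (n k : ℕ) (G : Graph n) → TreewidthIs G k →
    (∃[ q ] ∃[ E ] Run G (A n k) q E) ×
    (∀ q E → Run G (A n k) q E → SameEdges E G × q ≤ Bound C k n)
theorem6 = 33 , reconstruct , λ n k G ((D , small) , _) →
  run G (reconstruct n k) , λ q E → reconstruct-sound n k D small
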